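{- The fully looped path $P_n^{\circ}$ is Hoffman-London for all $n\ge 1$ and strongly Hoffman-London for all $n\ge 3$.
   Context: The fully looped path $P_n^{\circ}$ is the graph on vertex set $u_1,\ldots,u_n$ with edges $u_iu_{i+1}$ for $1\le i\le n-1$ and a loop $u_iu_i$ for each $1\le i\le n$. For a target graph $H$ (no multiple edges, possibly with loops) and a simple loopless graph $G$, an $H$-coloring of $G$ is a map $f:V(G)\to V(H)$ such that $f(u)\sim_H f(v)$ whenever $u\sim_G v$; $\hom(G,H)$ denotes the number of $H$-colorings of $G$. $\mathcal{T}_N$ is the set of all trees on $N$ vertices (up to isomorphism) and $P_N\in\mathcal{T}_N$ is the (loopless) path on $N$ vertices. $H$ is Hoffman-London if for all $N\ge 1$, $\hom(P_N,H)=\min_{T\in\mathcal{T}_N}\hom(T,H)$; $H$ is strongly Hoffman-London if $\hom(P_N,H)<\hom(T,H)$ for all $N\ge 1$ and all $T\in\mathcal{T}_N\setminus\{P_N\}$. -}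

module Defs where

open import Data.Fin using (Fin; zero; suc; toℕ; fromℕ; inject₁; _≟_)
open import Data.Fin.Permutation using (Permutation′; _⟨$⟩ʳ_)
open import Data.Fin.Properties using (all?)
open import Data.List using (List; []; _∷_; length; filter; allFin; cartesianProductWith)
open import Data.Nat using (ℕ; zero; suc; _≤_; _<_)
import Data.Nat as ℕ
open import Data.Nat.Properties using (1+n≢n)
open import Data.Product using (_×_; ∃-syntax)
open import Data.Sum using (_⊎_; inj₁; inj₂; swap; map)
open import Data.Vec using (Vec; []; _∷_; lookup)
open import Function using (_⇔_)
open import Function.Definitions using (Injective)
open import Level using (0ℓ)
open import Relation.Binary.Construct.Closure.ReflexiveTransitive using (Star)
open import Relation.Binary.Core using (Rel)
open import Relation.Binary.Definitions using (Decidable; Irreflexive; Symmetric)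
open import Relation.Binary.PropositionalEquality using (_≡_; refl; sym)
open import Relation.Nullary using (¬_; _⊎-dec_; _→-dec_)
import Relation.Unary as U

-- Graphs without multiple edges, with loops allowed, on the vertex set Fin n.
record Graph (n : ℕ) : Set₁ where
  field
    Adj     : Rel (Fin n) 0ℓ
    adj?    : Decidable Adj
    adj-sym : Symmetric Adj

record SimpleGraph (n : ℕ) : Set₁ where
  field
    graph    : Graph n
  open Graph graph public
  field
    loopless : Irreflexive _≡_ Adj

-- A colouring f : V(G) → V(H) is represented by its vector of values, so that
-- distinct colourings are propositionally distinct without extensionality.
IsColoring : ∀ {N n} → SimpleGraph N → Graph n → U.Pred (Vec (Fin n) N) 0ℓ
IsColoring G H f = ∀ u v → SimpleGraph.Adj G u v → Graph.Adj H (lookup f u) (lookup f v)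

isColoring? : ∀ {N n} (G : SimpleGraph N) (H : Graph n) → U.Decidable (IsColoring G H)
isColoring? G H f = all? λ u → all? λ v →
  SimpleGraph.adj? G u v →-dec Graph.adj? H (lookup f u) (lookup f v)

-- Every vector of length N over Fin n occurs exactly once.
allMaps : ∀ N n → List (Vec (Fin n) N)
allMaps zero    n = [] ∷ []
allMaps (suc N) n = cartesianProductWith _∷_ (allFin n) (allMaps N n)

hom : ∀ {N n} → SimpleGraph N → Graph n → ℕ
hom {N} {n} G H = length (filter (isColoring? G H) (allMaps N n))

module _ {N : ℕ} (G : SimpleGraph N) where
  open SimpleGraph G

  Connected : Set
  Connected = ∀ u v → Star Adj u v

  -- A cycle is a closed sequence of k + 3 distinct vertices c 0, …, c (k + 2).
  IsCycle : ∀ {k} → (Fin (3 ℕ.+ k) → Fin N) → Set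
  IsCycle {k} c = Injective _≡_ _≡_ c
                × (∀ (i : Fin (2 ℕ.+ k)) → Adj (c (inject₁ i)) (c (suc i)))
                × Adj (c (fromℕ (2 ℕ.+ k))) (c zero)

  Acyclic : Set
  Acyclic = ∀ {k} (c : Fin (3 ℕ.+ k) → Fin N) → ¬ IsCycle c

  -- The null graph (N = 0) satisfies this vacuously; trees are only ever
  -- considered below for N ≥ 1.
  IsTree : Set
  IsTree = Connected × Acyclic

_≅_ : ∀ {N} → SimpleGraph N → SimpleGraph N → Set
_≅_ {N} G G′ = ∃[ π ] (∀ u v → SimpleGraph.Adj G u v ⇔ SimpleGraph.Adj G′ (to π u) (to π v))
  where
  to : Permutation′ N → Fin N → Fin N
  to = _⟨$⟩ʳ_

Consecutive : ∀ {n} → Rel (Fin n) 0ℓ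
Consecutive i j = toℕ j ≡ suc (toℕ i) ⊎ toℕ i ≡ suc (toℕ j)

consecutive? : ∀ {n} → Decidable (Consecutive {n})
consecutive? i j = (toℕ j ℕ.≟ suc (toℕ i)) ⊎-dec (toℕ i ℕ.≟ suc (toℕ j))

path : ∀ N → SimpleGraph N
path N = record
  { graph    = record { Adj = Consecutive ; adj? = consecutive? ; adj-sym = swap }
  ; loopless = λ { refl (inj₁ e) → 1+n≢n (sym e) ; refl (inj₂ e) → 1+n≢n (sym e) }
  }

loopedPath : ∀ n → Graph n
loopedPath n = record
  { Adj     = λ i j → i ≡ j ⊎ Consecutive i j
  ; adj?    = λ i j → (i ≟ j) ⊎-dec consecutive? i j
  ; adj-sym = map sym swap
  }

-- m = min { hom(T, H) : T a tree on N vertices }.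
IsMinHom : ∀ {n} → Graph n → (N m : ℕ) → Set₁
IsMinHom H N m = (∃[ T ] (IsTree {N} T × hom T H ≡ m))
               × (∀ (T : SimpleGraph N) → IsTree T → m ≤ hom T H)

HoffmanLondon : ∀ {n} → Graph n → Set₁
HoffmanLondon H = ∀ N → 1 ≤ N → IsMinHom H N (hom (path N) H)

-- Trees are taken up to isomorphism, so T ≠ P_N means that T is not isomorphic
-- to P_N.
StronglyHoffmanLondon : ∀ {n} → Graph n → Set₁
StronglyHoffmanLondon H =
  ∀ N → 1 ≤ N → ∀ (T : SimpleGraph N) → IsTree T → ¬ (T ≅ path N) →
  hom (path N) H < hom T H

module Submission where

-- Let A be the adjacency matrix of H = P_n°. Call a vector of colour weights
-- central if it is monotone in the distance of a colour from the ends of H.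
-- Central vectors are closed under pointwise products and under A, so for every
-- rooted tree the number of colourings with a prescribed root colour is central.
-- Central vectors x, y are similarly ordered, so summing the nonnegative
-- quantities (Aᵏ)ᵢⱼ (xᵢ - xⱼ) (yᵢ - yⱼ) gives Chebyshev's inequality
-- ⟨x , Aᵏ y⟩ ≤ ⟨x , Aᵏ𝟙 ⊙ y⟩: two paths hanging from a common vertex admit at least
-- as many colourings as the one path obtained by concatenating them. Replacing
-- branches by paths from the leaves upwards compares any tree with the path. For
-- n ≥ 3 the inequality is strict at the first genuine branching, and a tree that
-- does not branch when it is rooted at a leaf is a path.

open import Defs
open import Data.Bool using (if_then_else_)
open import Data.Empty using (⊥-elim)
open import Data.Fin using (Fin; zero; suc; toℕ; fromℕ; fromℕ<; inject₁; punchIn; punchOut)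
import Data.Fin as Fin
open import Data.Fin.Permutation using (Permutation′; _⟨$⟩ʳ_; insert; insert-punchIn) renaming (id to idₚ)
open import Data.Fin.Properties
  using (toℕ<n; toℕ-injective; toℕ-fromℕ<; toℕ-inject₁; toℕ-fromℕ; any?; injective⇒≤;
         punchIn-injective; punchIn-punchOut; punchInᵢ≢i)
  renaming (suc-injective to Fin-suc-injective)
open import Data.List using (List; []; _∷_; _++_; length; filter; map; tabulate; cartesianProductWith)
open import Data.List.Properties using (map-++; map-∘)
open import Data.Nat
open import Data.Nat.ListAction using () renaming (sum to sumˡ)
open import Data.Nat.ListAction.Properties using (sum-++)
open import Data.Nat.Properties
open import Data.Nat.Tactic.RingSolver using (solve-∀)
open import Data.Product using (_×_; _,_; proj₁; proj₂; ∃-syntax)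
open import Data.Sum using (_⊎_; inj₁; inj₂)
import Data.Sum as Sum
open import Data.Vec using (Vec; []; _∷_; lookup; insertAt)
open import Data.Vec.Functional using (updateAt; removeAt)
open import Data.Vec.Functional.Properties using (updateAt-updates; updateAt-minimal)
open import Data.Vec.Properties using (insertAt-lookup; insertAt-punchIn)
open import Function using (_∘_; _⇔_; Equivalence; mk⇔; id; Injective)
open import Function.Bundles using (module Injection)
open import Function.Properties.Inverse using (↔⇒↣)
open import Relation.Binary.Construct.Closure.ReflexiveTransitive
  using (Star; ε; _◅_; _◅◅_; gmap; reverse; kleisliStar)
open import Relation.Binary.PropositionalEquality
open import Relation.Nullary
open import Relation.Nullary.Decidable using (decidable-stable)
open import Algebra.Properties.CommutativeMonoid.Sum *-1-commutativeMonoid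
  using () renaming (sum to product; sum-cong-≗ to product-cong; sum-remove to product-remove)
open import Algebra.Properties.Semiring.Sum +-*-semiring
  using (sum; sum-cong-≗; sum-remove; ∑-distrib-+; ∑-comm; *-distribˡ-sum; *-distribʳ-sum;
         sum-replicate-zero)

-- Weights on the colours

-- Binds looser than _*_ and tighter than _+_, unlike the standard library's notation.
infixr 6.5 ∑-syntax

∑-syntax : ∀ n → (Fin n → ℕ) → ℕ
∑-syntax _ = sum

syntax ∑-syntax n (λ i → x) = ∑[ i < n ] x

sum-mono-≤ : ∀ {n} {f g : Fin n → ℕ} → (∀ i → f i ≤ g i) → sum f ≤ sum g
sum-mono-≤ {zero}  f≤g = z≤n
sum-mono-≤ {suc n} f≤g = +-mono-≤ (f≤g zero) (sum-mono-≤ (f≤g ∘ suc))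

sum-mono-< : ∀ {n} {f g : Fin n → ℕ} → (∀ i → f i ≤ g i) → ∀ k → f k < g k → sum f < sum g
sum-mono-< f≤g zero    f<g = +-mono-<-≤ f<g (sum-mono-≤ (f≤g ∘ suc))
sum-mono-< f≤g (suc k) f<g = +-mono-≤-< (f≤g zero) (sum-mono-< (f≤g ∘ suc) k f<g)

indicator : ∀ {p} {P : Set p} → Dec P → ℕ
indicator P? = if does P? then 1 else 0

indicator-cong : ∀ {p q} {P : Set p} {Q : Set q} (P? : Dec P) (Q? : Dec Q) →
                 P ⇔ Q → indicator P? ≡ indicator Q?
indicator-cong (yes _) (yes _) _   = refl
indicator-cong (no _)  (no _)  _   = refl
indicator-cong (yes p) (no ¬q) P⇔Q = ⊥-elim (¬q (Equivalence.to P⇔Q p))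
indicator-cong (no ¬p) (yes q) P⇔Q = ⊥-elim (¬p (Equivalence.from P⇔Q q))

indicator-× : ∀ {p q} {P : Set p} {Q : Set q} (P? : Dec P) (Q? : Dec Q) →
              indicator (P? ×-dec Q?) ≡ indicator P? * indicator Q?
indicator-× (yes _) (yes _) = refl
indicator-× (yes _) (no _)  = refl
indicator-× (no _)  _       = refl

indicator-⊎ : ∀ {p q} {P : Set p} {Q : Set q} (P? : Dec P) (Q? : Dec Q) →
              ¬ (P × Q) → indicator (P? ⊎-dec Q?) ≡ indicator P? + indicator Q?
indicator-⊎ (yes p) (yes q) ¬pq = ⊥-elim (¬pq (p , q))
indicator-⊎ (yes _) (no _)  _   = refl
indicator-⊎ (no _)  (yes _) _   = refl
indicator-⊎ (no _)  (no _)  _   = refl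

indicator-yes : ∀ {p} {P : Set p} (P? : Dec P) → P → indicator P? ≡ 1
indicator-yes (yes _) _ = refl
indicator-yes (no ¬p) p = ⊥-elim (¬p p)

Weight : ℕ → Set
Weight n = Fin n → ℕ

infixl 7 _⊙_

_⊙_ : ∀ {n} → Weight n → Weight n → Weight n
(x ⊙ y) i = x i * y i

𝟙 : ∀ {n} → Weight n
𝟙 _ = 1

⟨_,_⟩ : ∀ {n} → Weight n → Weight n → ℕ
⟨ x , y ⟩ = sum (x ⊙ y)

⟨⟩-comm : ∀ {n} (x y : Weight n) → ⟨ x , y ⟩ ≡ ⟨ y , x ⟩
⟨⟩-comm x y = sum-cong-≗ λ i → *-comm (x i) (y i)

⟨⟩-⊙ : ∀ {n} (w x y : Weight n) → ⟨ w , x ⊙ y ⟩ ≡ ⟨ w ⊙ x , y ⟩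
⟨⟩-⊙ w x y = sum-cong-≗ λ i → sym (*-assoc (w i) (x i) (y i))

⟨⟩-⊙-comm : ∀ {n} (w x y : Weight n) → ⟨ w ⊙ x , y ⟩ ≡ ⟨ w ⊙ y , x ⟩
⟨⟩-⊙-comm w x y = sum-cong-≗ λ i → lemma (w i) (x i) (y i)
  where
  lemma : ∀ a b c → a * b * c ≡ a * c * b
  lemma = solve-∀

-- Rooted trees and the adjacency operator

infix 5 _◁_

-- `t ◁ s` joins the root of `s` by a new edge to that of `t`, which stays the root; one branch is
-- added at a time, as in leaf-by-leaf pruning.
data RootedTree : Set where
  •   : RootedTree
  _◁_ : (t s : RootedTree) → RootedTree

edges : RootedTree → ℕ
edges •       = 0
edges (t ◁ s) = edges t + suc (edges s)

-- Paths rooted at an end: with `t` other than `•`, the root of `t ◁ s` has at least two branches.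
data Linear : RootedTree → Set where
  •   : Linear •
  •◁_ : ∀ {s} → Linear s → Linear (• ◁ s)

module _ {n : ℕ} (H : Graph n) where
  open Graph H

  neighbourSum : Weight n → Weight n
  neighbourSum x i = ∑[ j < n ] indicator (adj? i j) * x j

  -- The adjacency matrix is symmetric. This identity moves the root of a count across an edge.
  neighbourSum-adjoint : ∀ x y → ⟨ neighbourSum x , y ⟩ ≡ ⟨ x , neighbourSum y ⟩
  neighbourSum-adjoint x y = begin
    ∑[ i < n ] neighbourSum x i * y i
      ≡⟨ (sum-cong-≗ λ i → *-distribʳ-sum (y i) (λ j → indicator (adj? i j) * x j)) ⟩
    ∑[ i < n ] ∑[ j < n ] indicator (adj? i j) * x j * y i
      ≡⟨ ∑-comm {n} {n} (λ i j → indicator (adj? i j) * x j * y i) ⟩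
    ∑[ j < n ] ∑[ i < n ] indicator (adj? i j) * x j * y i
      ≡⟨ (sum-cong-≗ λ j → sum-cong-≗ λ i → term i j) ⟩
    ∑[ j < n ] ∑[ i < n ] x j * (indicator (adj? j i) * y i)
      ≡⟨ (sum-cong-≗ λ j → *-distribˡ-sum (x j) (λ i → indicator (adj? j i) * y i)) ⟨
    ∑[ j < n ] x j * neighbourSum y j ∎
    where
    open ≡-Reasoning
    lemma : ∀ a b c → a * b * c ≡ b * (a * c)
    lemma = solve-∀
    term : ∀ i j → indicator (adj? i j) * x j * y i ≡ x j * (indicator (adj? j i) * y i)
    term i j = trans (lemma (indicator (adj? i j)) (x j) (y i))
      (cong (λ a → x j * (a * y i)) (indicator-cong (adj? i j) (adj? j i) (mk⇔ adj-sym adj-sym)))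

  neighbourSum-linear : ∀ c d x y i →
    neighbourSum (λ j → c * x j + d * y j) i ≡ c * neighbourSum x i + d * neighbourSum y i
  neighbourSum-linear c d x y i = begin
    ∑[ j < n ] a j * (c * x j + d * y j)
      ≡⟨ (sum-cong-≗ λ j → lemma (a j) c d (x j) (y j)) ⟩
    ∑[ j < n ] (c * (a j * x j) + d * (a j * y j))
      ≡⟨ ∑-distrib-+ (λ j → c * (a j * x j)) (λ j → d * (a j * y j)) ⟩
    ∑[ j < n ] c * (a j * x j) + ∑[ j < n ] d * (a j * y j)
      ≡⟨ cong₂ _+_ (*-distribˡ-sum c (λ j → a j * x j)) (*-distribˡ-sum d (λ j → a j * y j)) ⟨
    c * neighbourSum x i + d * neighbourSum y i ∎
    where
    open ≡-Reasoning
    a : Weight n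
    a j = indicator (adj? i j)
    lemma : ∀ a c d x y → a * (c * x + d * y) ≡ c * (a * x) + d * (a * y)
    lemma = solve-∀

  neighbourSum-cong : ∀ {x y} → x ≗ y → neighbourSum x ≗ neighbourSum y
  neighbourSum-cong x≗y i = sum-cong-≗ λ j → cong (indicator (adj? i j) *_) (x≗y j)

  neighbourSum-mono-≤ : ∀ {x y} → (∀ i → x i ≤ y i) → ∀ i → neighbourSum x i ≤ neighbourSum y i
  neighbourSum-mono-≤ x≤y i = sum-mono-≤ λ j → *-monoʳ-≤ (indicator (adj? i j)) (x≤y j)

  neighbourSum-mono-< : ∀ {x y} → (∀ i → x i ≤ y i) → ∀ {i j} → Adj i j → x j < y j →
                        neighbourSum x i < neighbourSum y i
  neighbourSum-mono-< {x} {y} x≤y {i} {j} i~j x<y =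
    sum-mono-< (λ k → *-monoʳ-≤ (indicator (adj? i k)) (x≤y k)) j strict
    where
    strict : indicator (adj? i j) * x j < indicator (adj? i j) * y j
    strict rewrite indicator-yes (adj? i j) i~j = +-monoˡ-< 0 x<y

  -- Powers of the adjacency matrix: `iter k 𝟙 i` counts the colourings of a path with `k` edges
  -- whose first vertex has colour `i`.
  iter : ℕ → Weight n → Weight n
  iter zero    x = x
  iter (suc k) x = neighbourSum (iter k x)

  iter-+ : ∀ k l x → iter (k + l) x ≡ iter k (iter l x)
  iter-+ zero    l x = refl
  iter-+ (suc k) l x = cong neighbourSum (iter-+ k l x)

  iter-suc : ∀ k x → iter k (neighbourSum x) ≡ iter (suc k) x
  iter-suc zero    x = refl
  iter-suc (suc k) x = cong neighbourSum (iter-suc k x)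

  iter-adjoint : ∀ k x y → ⟨ iter k x , y ⟩ ≡ ⟨ x , iter k y ⟩
  iter-adjoint zero    x y = refl
  iter-adjoint (suc k) x y = begin
    ⟨ neighbourSum (iter k x) , y ⟩ ≡⟨ neighbourSum-adjoint (iter k x) y ⟩
    ⟨ iter k x , neighbourSum y ⟩   ≡⟨ iter-adjoint k x (neighbourSum y) ⟩
    ⟨ x , iter k (neighbourSum y) ⟩ ≡⟨ cong ⟨ x ,_⟩ (iter-suc k y) ⟩
    ⟨ x , iter (suc k) y ⟩          ∎
    where open ≡-Reasoning

  iter-linear : ∀ k c d x y i →
    iter k (λ j → c * x j + d * y j) i ≡ c * iter k x i + d * iter k y i
  iter-linear zero    c d x y i = refl
  iter-linear (suc k) c d x y i = trans
    (neighbourSum-cong (iter-linear k c d x y) i)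
    (neighbourSum-linear c d (iter k x) (iter k y) i)

  iter-mono-≤ : ∀ k {x y} → (∀ i → x i ≤ y i) → ∀ i → iter k x i ≤ iter k y i
  iter-mono-≤ zero    x≤y = x≤y
  iter-mono-≤ (suc k) x≤y = neighbourSum-mono-≤ (iter-mono-≤ k x≤y)

  -- The number of colourings of t in which the root has a prescribed colour.
  rootedHom : RootedTree → Weight n
  rootedHom •       = 𝟙
  rootedHom (t ◁ s) = rootedHom t ⊙ neighbourSum (rootedHom s)

  ⟨⟩-⊙-neighbourSum : ∀ w x y → ⟨ w , x ⊙ neighbourSum y ⟩ ≡ ⟨ neighbourSum (w ⊙ x) , y ⟩
  ⟨⟩-⊙-neighbourSum w x y =
    trans (⟨⟩-⊙ w x (neighbourSum y)) (sym (neighbourSum-adjoint (w ⊙ x) y))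

-- Similarly ordered pairs and central weights

SimilarlyOrdered : (a b a′ b′ : ℕ) → Set
SimilarlyOrdered a b a′ b′ = (a ≤ a′ × b ≤ b′) ⊎ (a′ ≤ a × b′ ≤ b)

-- This is (a′ - a)(b′ - b) ≥ 0 without subtraction; the slack is the product of the differences `d`
-- and `e`.
similarlyOrdered-≤ : ∀ {a b a′ b′} → SimilarlyOrdered a b a′ b′ →
                     a * b′ + b * a′ ≤ a′ * b′ + a * b
similarlyOrdered-≤ {a} {b} {a′} {b′} (inj₁ (a≤a′ , b≤b′))
  with d , refl ← m≤n⇒∃[o]m+o≡n a≤a′ | e , refl ← m≤n⇒∃[o]m+o≡n b≤b′ =
  m+n≤o⇒m≤o _ (≤-reflexive (lemma a b d e))
  where
  lemma : ∀ a b d e → a * (b + e) + b * (a + d) + d * e ≡ (a + d) * (b + e) + a * b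
  lemma = solve-∀
similarlyOrdered-≤ {a} {b} {a′} {b′} (inj₂ (a′≤a , b′≤b))
  with d , refl ← m≤n⇒∃[o]m+o≡n a′≤a | e , refl ← m≤n⇒∃[o]m+o≡n b′≤b =
  m+n≤o⇒m≤o _ (≤-reflexive (lemma a′ b′ d e))
  where
  lemma : ∀ a b d e → (a + d) * b + (b + e) * a + d * e ≡ a * b + (a + d) * (b + e)
  lemma = solve-∀

similarlyOrdered-< : ∀ {a b a′ b′} → a < a′ → b < b′ → a * b′ + b * a′ < a′ * b′ + a * b
similarlyOrdered-< {a} {b} a<a′ b<b′
  with d , refl ← m≤n⇒∃[o]m+o≡n a<a′ | e , refl ← m≤n⇒∃[o]m+o≡n b<b′ =
  -- The differences are now 1 + d and 1 + e, and (1 + d)(1 + e) = 1 + (de + d + e) supplies the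
  -- extra unit.
  m+n≤o⇒m≤o _ (≤-reflexive (lemma a b d e))
  where
  lemma : ∀ a b d e → suc (a * (suc b + e) + b * (suc a + d)) + (d * e + d + e)
                      ≡ (suc a + d) * (suc b + e) + a * b
  lemma = solve-∀

-- Position a of the segment [0, m] is at most as central as position b.
data Outer (m a b : ℕ) : Set where
  left  : a ≤ b → a + b ≤ m → Outer m a b
  right : b ≤ a → m ≤ a + b → Outer m a b

-- The more central position is determined by which of `a` and `b` is larger and by the side of the
-- midpoint of [0, m] on which their mean lies. Totality is what makes central weights similarly
-- ordered.
outer-total : ∀ m a b → Outer m a b ⊎ Outer m b a
outer-total m a b with ≤-total a b | ≤-total (a + b) m
... | inj₁ a≤b | inj₁ s≤m = inj₁ (left a≤b s≤m)
... | inj₁ a≤b | inj₂ m≤s = inj₂ (right a≤b (subst (m ≤_) (+-comm a b) m≤s))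
... | inj₂ b≤a | inj₁ s≤m = inj₂ (left b≤a (subst (_≤ m) (+-comm a b) s≤m))
... | inj₂ b≤a | inj₂ m≤s = inj₁ (right b≤a m≤s)

outer-mirror : ∀ {m} a b → a + b ≡ m → Outer m a b
outer-mirror a b refl with ≤-total a b
... | inj₁ a≤b = left a≤b ≤-refl
... | inj₂ b≤a = right b≤a ≤-refl

extend : ∀ {n} → Weight n → ℕ → ℕ
extend {zero}  x k       = 0
extend {suc n} x zero    = x zero
extend {suc n} x (suc k) = extend (x ∘ suc) k

extend-toℕ : ∀ {n} (x : Weight n) i → extend x (toℕ i) ≡ x i
extend-toℕ x zero    = refl
extend-toℕ x (suc i) = extend-toℕ (x ∘ suc) i

extend-≥ : ∀ {n} (x : Weight n) {k} → n ≤ k → extend x k ≡ 0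
extend-≥ {zero}  x n≤k       = refl
extend-≥ {suc n} x (s≤s n≤k) = extend-≥ (x ∘ suc) n≤k

-- Colours are the positions 1, …, n of [0, n + 1]; outside them a weight vanishes.
pad : ∀ {n} → Weight n → ℕ → ℕ
pad x zero    = 0
pad x (suc k) = extend x k

sum-indicator : ∀ {n} (x : Weight n) k → ∑[ j < n ] indicator (toℕ j ≟ k) * x j ≡ extend x k
sum-indicator {zero}  x k       = refl
sum-indicator {suc n} x zero    = trans (cong (_+_ _) (sum-replicate-zero n)) (lemma (x zero))
  where
  lemma : ∀ a → a + 0 + 0 ≡ a
  lemma = solve-∀
sum-indicator {suc n} x (suc k) = sum-indicator (x ∘ suc) k

sum-indicator-suc : ∀ {n} (x : Weight n) a → ∑[ j < n ] indicator (suc (toℕ j) ≟ a) * x j ≡ pad x a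
sum-indicator-suc {n} x zero    = sum-replicate-zero n
sum-indicator-suc     x (suc k) = sum-indicator x k

-- Colour `i` has position `1 + toℕ i`; its loop and its two neighbours fill the window of three
-- positions that starts at `toℕ i`. The zero padding makes the formula uniform up to the ends of
-- the path.
neighbourSum-loopedPath : ∀ {n} (x : Weight n) i → neighbourSum (loopedPath n) x i ≡
  pad x (toℕ i) + pad x (1 + toℕ i) + pad x (2 + toℕ i)
neighbourSum-loopedPath {n} x i = begin
  ∑[ j < n ] indicator (Graph.adj? (loopedPath n) i j) * x j
    ≡⟨ (sum-cong-≗ λ j → trans (cong (_* x j) (split j)) (distrib (at 0 j) (at 1 j) (at 2 j) (x j))) ⟩
  ∑[ j < n ] (at 0 j * x j + at 1 j * x j + at 2 j * x j)
    ≡⟨ ∑-distrib-+ (λ j → at 0 j * x j + at 1 j * x j) (λ j → at 2 j * x j) ⟩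
  ∑[ j < n ] (at 0 j * x j + at 1 j * x j) + ∑[ j < n ] at 2 j * x j
    ≡⟨ cong (_+ ∑[ j < n ] at 2 j * x j) (∑-distrib-+ (λ j → at 0 j * x j) (λ j → at 1 j * x j)) ⟩
  ∑[ j < n ] at 0 j * x j + ∑[ j < n ] at 1 j * x j + ∑[ j < n ] at 2 j * x j
    ≡⟨ cong₂ _+_ (cong₂ _+_ (sum-indicator-suc x (toℕ i)) (sum-indicator-suc x (1 + toℕ i)))
                 (sum-indicator-suc x (2 + toℕ i)) ⟩
  pad x (toℕ i) + pad x (1 + toℕ i) + pad x (2 + toℕ i) ∎
  where
  open ≡-Reasoning
  at : ℕ → Weight n
  at k j = indicator (suc (toℕ j) ≟ k + toℕ i)
  distrib : ∀ a b c y → (a + b + c) * y ≡ a * y + b * y + c * y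
  distrib = solve-∀
  rotate : ∀ a b c → a + (b + c) ≡ c + a + b
  rotate = solve-∀
  split : ∀ j → indicator (Graph.adj? (loopedPath n) i j) ≡ at 0 j + at 1 j + at 2 j
  split j = begin
    indicator ((i Fin.≟ j) ⊎-dec consecutive? i j)
      ≡⟨ indicator-⊎ (i Fin.≟ j) (consecutive? i j) (λ { (refl , c) → SimpleGraph.loopless (path n) refl c }) ⟩
    indicator (i Fin.≟ j) + indicator (consecutive? i j)
      ≡⟨ cong (indicator (i Fin.≟ j) +_) (indicator-⊎ (toℕ j ≟ suc (toℕ i)) (toℕ i ≟ suc (toℕ j))
           (λ (p , q) → m≢1+n+m (toℕ j) {1} (trans p (cong suc q)))) ⟩
    indicator (i Fin.≟ j) + (indicator (toℕ j ≟ suc (toℕ i)) + indicator (toℕ i ≟ suc (toℕ j)))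
      ≡⟨ cong₂ (λ a b → a + (at 2 j + b))
           (indicator-cong (i Fin.≟ j) (suc (toℕ j) ≟ suc (toℕ i))
             (mk⇔ (λ { refl → refl }) (λ e → toℕ-injective (sym (suc-injective e)))))
           (indicator-cong (toℕ i ≟ suc (toℕ j)) (suc (toℕ j) ≟ toℕ i) (mk⇔ sym sym)) ⟩
    at 1 j + (at 2 j + at 0 j)
      ≡⟨ rotate (at 1 j) (at 2 j) (at 0 j) ⟩
    at 0 j + at 1 j + at 2 j ∎

Central : ∀ {n} → Weight n → Set
Central {n} x = ∀ i j → Outer (suc n) (suc (toℕ i)) (suc (toℕ j)) → x i ≤ x j

data Position (n : ℕ) : ℕ → Set where
  below  : Position n 0
  inside : ∀ (i : Fin n) → Position n (suc (toℕ i))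
  above  : ∀ {k} → n ≤ k → Position n (suc k)

position : ∀ n a → Position n a
position n zero    = below
position n (suc k) with n ≤? k
... | yes n≤k = above n≤k
... | no  n≰k = subst (λ l → Position n (suc l)) (toℕ-fromℕ< (≰⇒> n≰k)) (inside (fromℕ< (≰⇒> n≰k)))

-- No padding position is at least as central as a colour, so the zeros placed there respect the
-- order.
pad-mono : ∀ {n} {x : Weight n} → Central x → ∀ {a b} → Outer (suc n) a b → pad x a ≤ pad x b
pad-mono {n} {x} central {a} {b} a⊑b with position n a
... | below     = z≤n
... | above n≤k rewrite extend-≥ x n≤k = z≤n
... | inside i with position n b
...   | inside j rewrite extend-toℕ x i | extend-toℕ x j = central i j a⊑b
pad-mono {n} central (right b≤a m≤s) | inside i | below =
  ⊥-elim (<⇒≱ (toℕ<n i) (s≤s⁻¹ (subst (suc n ≤_) (+-identityʳ _) m≤s)))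
pad-mono central (left a≤b s≤m)  | inside i | above {k} n≤k =
  ⊥-elim (<⇒≱ (s≤s n≤k) (m+n≤o⇒n≤o (toℕ i) (s≤s⁻¹ s≤m)))
pad-mono central (right b≤a m≤s) | inside i | above {k} n≤k =
  ⊥-elim (<⇒≱ (toℕ<n i) (≤-trans n≤k (s≤s⁻¹ b≤a)))

central-𝟙 : ∀ {n} → Central (𝟙 {n})
central-𝟙 _ _ _ = ≤-refl

central-⊙ : ∀ {n} {x y : Weight n} → Central x → Central y → Central (x ⊙ y)
central-⊙ cx cy i j i⊑j = *-mono-≤ (cx i j i⊑j) (cy i j i⊑j)

-- The windows around the two colours are matched term by term, each position around `i` with one
-- around `j` that is at least as central.
central-neighbourSum : ∀ {n} {x : Weight n} → Central x → Central (neighbourSum (loopedPath n) x)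
central-neighbourSum {n} {x} cx i j i⊑j
  rewrite neighbourSum-loopedPath x i | neighbourSum-loopedPath x j = go (toℕ i) (toℕ j) i⊑j
  where
  m : ℕ
  m = suc n
  X : ℕ → ℕ
  X = pad x
  mono : ∀ {a b} → Outer m a b → X a ≤ X b
  mono = pad-mono cx
  window : ℕ → ℕ
  window k = X k + X (1 + k) + X (2 + k)
  mirror : ∀ a b c → c + b + a ≡ a + b + c
  mirror = solve-∀
  shiftʳ : ∀ a b c → c + a + b ≡ a + b + c
  shiftʳ = solve-∀
  shiftˡ : ∀ a b c → b + c + a ≡ a + b + c
  shiftˡ = solve-∀
  go : ∀ k l → Outer m (1 + k) (1 + l) → window k ≤ window l
  go k l o with k ≟ l
  go k l o | yes refl = ≤-refl
  go k l (left k≤l s≤m) | no k≢l rewrite +-suc k l with m≤n⇒m<n∨m≡n s≤m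
  -- Plain translation may fail, since `2 + k` and `2 + l` can add up to more than `m`. In the
  -- cyclic matching used here every sum exceeds that of the centres by at most one.
  ... | inj₁ s<m = subst (window k ≤_) (shiftʳ (X l) (X (1 + l)) (X (2 + l)))
    (+-mono-≤ (+-mono-≤
      (mono {k} {2 + l} (left (m≤n⇒m≤1+n (<⇒≤ k≤l)) (subst (_≤ m) (sym (trans (+-suc k (suc l)) (cong suc (+-suc k l)))) s≤m)))
      (mono {1 + k} {l} (left k<l (≤-trans (n≤1+n _) s≤m))))
      (mono {2 + k} {1 + l} (left (s≤s k<l) (subst (λ z → suc (suc z) ≤ m) (sym (+-suc k l)) s<m))))
    where
    k<l : k < l
    k<l = ≤∧≢⇒< (s≤s⁻¹ k≤l) k≢l
  -- The centres add up to `m`, so reflection carries one window onto the other.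
  ... | inj₂ s≡m = subst (window k ≤_) (mirror (X l) (X (1 + l)) (X (2 + l)))
    (+-mono-≤ (+-mono-≤
      (mono {k} {2 + l} (outer-mirror k (2 + l) (trans (trans (+-suc k (suc l)) (cong suc (+-suc k l))) s≡m)))
      (mono {1 + k} {1 + l} (outer-mirror (1 + k) (1 + l) (trans (cong suc (+-suc k l)) s≡m))))
      (mono {2 + k} {l} (outer-mirror (2 + k) l s≡m)))
  go k l (right l≤k m≤s) | no k≢l rewrite +-suc k l with m≤n⇒m<n∨m≡n m≤s
  ... | inj₁ m<s = subst (window k ≤_) (shiftˡ (X l) (X (1 + l)) (X (2 + l)))
    (+-mono-≤ (+-mono-≤
      (mono {k} {1 + l} (right l<k (subst (m ≤_) (sym (+-suc k l)) (s≤s⁻¹ m<s))))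
      (mono {1 + k} {2 + l} (right (s≤s l<k)
        (≤-trans m≤s (subst (_≤ suc (k + suc (suc l))) (cong suc (+-suc k l)) (s≤s (+-monoʳ-≤ k (n≤1+n (suc l)))))))))
      (mono {2 + k} {l} (right (m≤n⇒m≤1+n (m≤n⇒m≤1+n (<⇒≤ l<k))) m≤s)))
    where
    l<k : l < k
    l<k = ≤∧≢⇒< (s≤s⁻¹ l≤k) (k≢l ∘ sym)
  ... | inj₂ m≡s = subst (window k ≤_) (mirror (X l) (X (1 + l)) (X (2 + l)))
    (+-mono-≤ (+-mono-≤
      (mono {k} {2 + l} (outer-mirror k (2 + l) (trans (trans (+-suc k (suc l)) (cong suc (+-suc k l))) (sym m≡s))))
      (mono {1 + k} {1 + l} (outer-mirror (1 + k) (1 + l) (trans (cong suc (+-suc k l)) (sym m≡s)))))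
      (mono {2 + k} {l} (outer-mirror (2 + k) l (sym m≡s))))

-- Chebyshev's inequality

central-similarlyOrdered : ∀ {n} {x y : Weight n} → Central x → Central y →
                           ∀ i j → SimilarlyOrdered (x i) (y i) (x j) (y j)
central-similarlyOrdered cx cy i j =
  Sum.map (λ o → cx i j o , cy i j o) (λ o → cx j i o , cy j i o) (outer-total _ _ _)

central-iter : ∀ {n} k {x : Weight n} → Central x → Central (iter (loopedPath n) k x)
central-iter zero    cx = cx
central-iter (suc k) cx = central-neighbourSum (central-iter k cx)

central-rootedHom : ∀ {n} t → Central (rootedHom (loopedPath n) t)
central-rootedHom •       = central-𝟙
central-rootedHom (t ◁ s) =
  central-⊙ (central-rootedHom t) (central-neighbourSum (central-rootedHom s))

module _ {n : ℕ} where

  private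
    H : Graph n
    H = loopedPath n

  module _ (k : ℕ) (x y : Weight n) where

    -- Fixing a colour i, these are the two sides of the expansion of
    -- (x j - x i) (y j - y i) ≥ 0, as functions of j.
    crossTerms squareTerms : Fin n → Weight n
    crossTerms  i j = x i * y j + y i * x j
    squareTerms i j = 1 * (x ⊙ y) j + (x ⊙ y) i * 𝟙 {n} j

    -- Evaluating `iter H k` at `i` multiplies the term in `j` by the (i, j) entry of Aᵏ, which
    -- makes this a double sum. Its two halves agree because Aᵏ is symmetric.
    sum-crossTerms : ∑[ i < n ] iter H k (crossTerms i) i ≡ ⟨ x , iter H k y ⟩ + ⟨ x , iter H k y ⟩
    sum-crossTerms = begin
      ∑[ i < n ] iter H k (crossTerms i) i
        ≡⟨ (sum-cong-≗ λ i → iter-linear H k (x i) (y i) y x i) ⟩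
      sum (λ i → x i * iter H k y i + y i * iter H k x i)
        ≡⟨ ∑-distrib-+ (x ⊙ iter H k y) (y ⊙ iter H k x) ⟩
      ⟨ x , iter H k y ⟩ + ⟨ y , iter H k x ⟩
        ≡⟨ cong (⟨ x , iter H k y ⟩ +_) (trans (⟨⟩-comm y (iter H k x)) (iter-adjoint H k x y)) ⟩
      ⟨ x , iter H k y ⟩ + ⟨ x , iter H k y ⟩ ∎
      where open ≡-Reasoning

    -- Each term depends on one colour only, and summing over the other leaves the row sums
    -- `iter H k 𝟙`. The factors `1` and `𝟙` give the terms the shape of `iter-linear`.
    sum-squareTerms : ∑[ i < n ] iter H k (squareTerms i) i ≡
                      ⟨ x , iter H k 𝟙 ⊙ y ⟩ + ⟨ x , iter H k 𝟙 ⊙ y ⟩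
    sum-squareTerms = begin
      ∑[ i < n ] iter H k (squareTerms i) i
        ≡⟨ (sum-cong-≗ λ i → iter-linear H k 1 ((x ⊙ y) i) (x ⊙ y) 𝟙 i) ⟩
      sum (λ i → 1 * iter H k (x ⊙ y) i + (x ⊙ y) i * iter H k 𝟙 i)
        ≡⟨ ∑-distrib-+ (𝟙 ⊙ iter H k (x ⊙ y)) ((x ⊙ y) ⊙ iter H k 𝟙) ⟩
      ⟨ 𝟙 , iter H k (x ⊙ y) ⟩ + ⟨ x ⊙ y , iter H k 𝟙 ⟩
        ≡⟨ cong₂ _+_ (trans (sym (iter-adjoint H k 𝟙 (x ⊙ y))) (⟨⟩-comm (iter H k 𝟙) (x ⊙ y))) refl ⟩
      ⟨ x ⊙ y , iter H k 𝟙 ⟩ + ⟨ x ⊙ y , iter H k 𝟙 ⟩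
        ≡⟨ cong (λ a → a + a) (trans (⟨⟩-⊙-comm x y (iter H k 𝟙)) (sym (⟨⟩-⊙ x (iter H k 𝟙) y))) ⟩
      ⟨ x , iter H k 𝟙 ⊙ y ⟩ + ⟨ x , iter H k 𝟙 ⊙ y ⟩ ∎
      where open ≡-Reasoning

    module _ (cx : Central x) (cy : Central y) where

      crossTerms≤squareTerms : ∀ i j → crossTerms i j ≤ squareTerms i j
      crossTerms≤squareTerms i j = subst (crossTerms i j ≤_)
        (cong₂ _+_ (sym (*-identityˡ ((x ⊙ y) j))) (sym (*-identityʳ ((x ⊙ y) i))))
        (similarlyOrdered-≤ (central-similarlyOrdered cx cy i j))

      chebyshev-≤ : ⟨ x , iter H k y ⟩ ≤ ⟨ x , iter H k 𝟙 ⊙ y ⟩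
      -- The double sums give twice each side, so a strict reversal is doubled into a contradiction.
      chebyshev-≤ = ≮⇒≥ λ b<a → <⇒≱ (+-mono-< b<a b<a)
        (subst₂ _≤_ sum-crossTerms sum-squareTerms
          (sum-mono-≤ λ i → iter-mono-≤ H k (crossTerms≤squareTerms i) i))

-- The strict inequalities only use that the first colour has strictly smaller
-- weight than the second one; from three colours on, neighbourSum creates such a gap.
record Peaked {n : ℕ} (x : Weight (3 + n)) : Set where
  field
    central  : Central x
    positive : ∀ i → 0 < x i
    gap      : x zero < x (suc zero)

module _ {n : ℕ} where

  private
    H : Graph (3 + n)
    H = loopedPath (3 + n)

  positive-neighbourSum : ∀ {x} → (∀ i → 0 < x i) → ∀ i → 0 < neighbourSum H x i
  positive-neighbourSum {x} 0<x i =
    ≤-<-trans z≤n (neighbourSum-mono-< H {x = λ _ → 0} {y = x} (λ _ → z≤n) {i} {i} (inj₁ refl) (0<x i))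

  peaked-neighbourSum : ∀ {x} → Central x → (∀ i → 0 < x i) → Peaked (neighbourSum H x)
  peaked-neighbourSum {x} cx 0<x = record
    { central  = central-neighbourSum cx
    ; positive = positive-neighbourSum 0<x
    -- The windows of the first two colours differ exactly by the third colour, whose weight is
    -- positive.
    ; gap      = subst₂ _<_ (sym (neighbourSum-loopedPath x zero)) (sym (neighbourSum-loopedPath x (suc zero)))
                   (m<m+n (x zero + x (suc zero)) (0<x (suc (suc zero))))
    }

  positive-iter : ∀ k → ∀ i → 0 < iter H k 𝟙 i
  positive-iter zero    _ = s≤s z≤n
  positive-iter (suc k)   = positive-neighbourSum (positive-iter k)

  peaked-iter : ∀ k → Peaked (iter H (suc k) 𝟙)
  peaked-iter k = peaked-neighbourSum (central-iter k central-𝟙) (positive-iter k)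

  -- The loop at the second colour preserves strictness there at every step.
  iter-mono-< : ∀ k {x y} → (∀ i → x i ≤ y i) → x (suc zero) < y (suc zero) →
                iter H k x (suc zero) < iter H k y (suc zero)
  iter-mono-< zero    x≤y x<y = x<y
  iter-mono-< (suc k) x≤y x<y =
    neighbourSum-mono-< H (iter-mono-≤ H k x≤y) (inj₁ refl) (iter-mono-< k x≤y x<y)

  -- One strict term of the double sum suffices, that of the first two colours. Its coefficient is
  -- positive: a walk between them can use the loop `k` times and the edge once. For exponent zero
  -- both sides would agree, hence `suc k`.
  chebyshev-< : ∀ k {x y} → Peaked x → Peaked y →
                ⟨ x , iter H (suc k) y ⟩ < ⟨ x , iter H (suc k) 𝟙 ⊙ y ⟩
  chebyshev-< k {x} {y} px py = ≰⇒> λ b≤a → <⇒≱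
    (subst₂ _<_ (sum-crossTerms (suc k) x y) (sum-squareTerms (suc k) x y)
      (sum-mono-< (λ i → iter-mono-≤ H (suc k) (cross≤square i) i) zero
        (neighbourSum-mono-< H (iter-mono-≤ H k (cross≤square zero)) (inj₂ (inj₁ refl))
          (iter-mono-< k (cross≤square zero) cross<square))))
    (+-mono-≤ b≤a b≤a)
    where
    open Peaked
    cross≤square : ∀ i j → crossTerms (suc k) x y i j ≤ squareTerms (suc k) x y i j
    cross≤square = crossTerms≤squareTerms (suc k) x y (central px) (central py)
    cross<square : crossTerms (suc k) x y zero (suc zero) < squareTerms (suc k) x y zero (suc zero)
    cross<square = subst (crossTerms (suc k) x y zero (suc zero) <_)
      (cong₂ _+_ (sym (*-identityˡ ((x ⊙ y) (suc zero)))) (sym (*-identityʳ ((x ⊙ y) zero))))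
      (similarlyOrdered-< (gap px) (gap py))

-- Replacing branches by paths

module _ {n : ℕ} where

  private
    H : Graph n
    H = loopedPath n

  mutual

    -- Chebyshev first bends the long path into two paths hanging from the root, with `edges t` and
    -- `suc (edges s)` edges; these are then replaced by the actual branches. The weight `w` is
    -- arbitrary because in the induction it stands for the rest of the tree.
    rootedHom-≥ : ∀ t {w : Weight n} → Central w → ⟨ w , iter H (edges t) 𝟙 ⟩ ≤ ⟨ w , rootedHom H t ⟩
    rootedHom-≥ •       cw = ≤-refl
    rootedHom-≥ (t ◁ s) {w} cw = ≤-trans
      (subst (λ x → ⟨ w , x ⟩ ≤ ⟨ w , iter H (edges t) 𝟙 ⊙ iter H (suc (edges s)) 𝟙 ⟩)
        (sym (iter-+ H (edges t) (suc (edges s)) 𝟙))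
        (chebyshev-≤ (edges t) w (iter H (suc (edges s)) 𝟙) cw (central-iter (suc (edges s)) central-𝟙)))
      (rootedHom-◁-≥ t s cw)

    -- One path is replaced at a time while everything else is absorbed into the root weight: first
    -- `s`, seen from its own root by adjointness, then `t`. Closure under products and
    -- `neighbourSum` keeps both weights central.
    rootedHom-◁-≥ : ∀ t s {w : Weight n} → Central w →
      ⟨ w , iter H (edges t) 𝟙 ⊙ iter H (suc (edges s)) 𝟙 ⟩ ≤ ⟨ w , rootedHom H (t ◁ s) ⟩
    rootedHom-◁-≥ t s {w} cw = begin
      ⟨ w , p ⊙ neighbourSum H q ⟩
        ≡⟨ ⟨⟩-⊙-neighbourSum H w p q ⟩
      ⟨ neighbourSum H (w ⊙ p) , q ⟩
        ≤⟨ rootedHom-≥ s (central-neighbourSum (central-⊙ cw (central-iter (edges t) central-𝟙))) ⟩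
      ⟨ neighbourSum H (w ⊙ p) , y ⟩
        ≡⟨ neighbourSum-adjoint H (w ⊙ p) y ⟩
      ⟨ w ⊙ p , neighbourSum H y ⟩
        ≡⟨ ⟨⟩-⊙-comm w p (neighbourSum H y) ⟩
      ⟨ w ⊙ neighbourSum H y , p ⟩
        ≤⟨ rootedHom-≥ t (central-⊙ cw (central-neighbourSum (central-rootedHom s))) ⟩
      ⟨ w ⊙ neighbourSum H y , x ⟩
        ≡⟨ ⟨⟩-⊙-comm w (neighbourSum H y) x ⟩
      ⟨ w ⊙ x , neighbourSum H y ⟩
        ≡⟨ ⟨⟩-⊙ w x (neighbourSum H y) ⟨
      ⟨ w , x ⊙ neighbourSum H y ⟩ ∎
      where
      open ≤-Reasoning
      p q x y : Weight n
      p = iter H (edges t) 𝟙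
      q = iter H (edges s) 𝟙
      x = rootedHom H t
      y = rootedHom H s

-- Descending past roots with a single branch keeps the weight peaked. Either the tree ends and is
-- linear, or two branches meet; there Chebyshev is strict and the weak bound finishes.
rootedHom-> : ∀ {n} t {w : Weight (3 + n)} → Peaked w →
  Linear t ⊎ ⟨ w , iter (loopedPath (3 + n)) (edges t) 𝟙 ⟩ < ⟨ w , rootedHom (loopedPath (3 + n)) t ⟩
rootedHom-> • pw = inj₁ •
rootedHom-> {n} (• ◁ s) {w} pw = Sum.map •◁_ extendRoot
  (rootedHom-> s (peaked-neighbourSum (Peaked.central pw) (Peaked.positive pw)))
  where
  H : Graph (3 + n)
  H = loopedPath (3 + n)
  extendRoot : ⟨ neighbourSum H w , iter H (edges s) 𝟙 ⟩ < ⟨ neighbourSum H w , rootedHom H s ⟩ →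
               ⟨ w , iter H (suc (edges s)) 𝟙 ⟩ < ⟨ w , 𝟙 ⊙ neighbourSum H (rootedHom H s) ⟩
  extendRoot = subst₂ _<_ (neighbourSum-adjoint H w (iter H (edges s) 𝟙))
    (trans (neighbourSum-adjoint H w (rootedHom H s))
      (sum-cong-≗ λ i → cong (w i *_) (sym (*-identityˡ (neighbourSum H (rootedHom H s) i)))))
rootedHom-> {n} (t@(t₁ ◁ t₂) ◁ s) {w} pw = inj₂ (<-≤-trans
  (subst (λ x → ⟨ w , x ⟩ < ⟨ w , iter H (edges t) 𝟙 ⊙ iter H (suc (edges s)) 𝟙 ⟩)
    (sym (iter-+ H (edges t) (suc (edges s)) 𝟙)) merge)
  (rootedHom-◁-≥ t s (Peaked.central pw)))
  where
  H : Graph (3 + n)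
  H = loopedPath (3 + n)
  merge : ⟨ w , iter H (edges t) (iter H (suc (edges s)) 𝟙) ⟩ <
          ⟨ w , iter H (edges t) 𝟙 ⊙ iter H (suc (edges s)) 𝟙 ⟩
  -- The rewriting exposes the number of edges of `t` as a successor, as `chebyshev-<` requires.
  merge rewrite +-suc (edges t₁) (edges t₂) =
    chebyshev-< (edges t₁ + edges t₂) pw (peaked-iter (edges s))

-- Weighted colourings and removal of a leaf

product-updateAt : ∀ {N n} (x : Fin N → Weight n) p (z : Weight n) (s : Fin N → Fin n) →
  product (λ v → updateAt x p (_⊙ z) v (s v)) ≡ z (s p) * product (λ v → x v (s v))
product-updateAt x zero    z s = lemma (x zero (s zero)) (z (s zero)) _
  where
  lemma : ∀ a b c → a * b * c ≡ b * (a * c)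
  lemma = solve-∀
product-updateAt x (suc p) z s = trans
  (cong (x zero (s zero) *_) (product-updateAt (x ∘ suc) p z (s ∘ suc)))
  (lemma (x zero (s zero)) (z (s (suc p))) _)
  where
  lemma : ∀ a b c → a * (b * c) ≡ b * (a * c)
  lemma = solve-∀

-- An iterated sum replaces the list `allMaps`, so that the colour of any chosen vertex can be
-- summed first.
sumMaps : ∀ {n} N → (Vec (Fin n) N → ℕ) → ℕ
sumMaps     zero    F = F []
sumMaps {n} (suc N) F = ∑[ i < n ] sumMaps N (F ∘ (i ∷_))

sumMaps-cong : ∀ {n} N {F F′ : Vec (Fin n) N → ℕ} → F ≗ F′ → sumMaps N F ≡ sumMaps N F′
sumMaps-cong zero    F≗F′ = F≗F′ []
sumMaps-cong (suc N) F≗F′ = sum-cong-≗ λ i → sumMaps-cong N (F≗F′ ∘ (i ∷_))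

sumMaps-insertAt : ∀ {n} N (ℓ : Fin (suc N)) (F : Vec (Fin n) (suc N) → ℕ) →
  sumMaps (suc N) F ≡ ∑[ i < n ] sumMaps N (λ f → F (insertAt f ℓ i))
sumMaps-insertAt     N       zero    F = refl
sumMaps-insertAt {n} (suc N) (suc ℓ) F = trans
  (sum-cong-≗ λ j → sumMaps-insertAt N ℓ (F ∘ (j ∷_)))
  (∑-comm {n} {n} (λ j i → sumMaps N (λ f → F (j ∷ insertAt f ℓ i))))

∑-sumMaps-comm : ∀ {n} N m (F : Fin m → Vec (Fin n) N → ℕ) →
  ∑[ i < m ] sumMaps N (F i) ≡ sumMaps N (λ f → ∑[ i < m ] F i f)
∑-sumMaps-comm     zero    m F = refl
∑-sumMaps-comm {n} (suc N) m F = trans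
  (∑-comm {m} {n} (λ i j → sumMaps N (F i ∘ (j ∷_))))
  (sum-cong-≗ λ j → ∑-sumMaps-comm N m (λ i → F i ∘ (j ∷_)))

sumMaps-allMaps : ∀ {n} N (F : Vec (Fin n) N → ℕ) → sumˡ (map F (allMaps N n)) ≡ sumMaps N F
sumMaps-allMaps     zero    F = +-identityʳ (F [])
sumMaps-allMaps {n} (suc N) F = go n id
  where
  -- `allFin n` is `tabulate id`; the induction needs an arbitrary tabulated function.
  go : ∀ m (c : Fin m → Fin n) →
       sumˡ (map F (cartesianProductWith _∷_ (tabulate c) (allMaps N n))) ≡
       ∑[ i < m ] sumMaps N (F ∘ (c i ∷_))
  go zero    c = refl
  go (suc m) c = begin
    sumˡ (map F (map (c zero ∷_) fs ++ rest))
      ≡⟨ cong sumˡ (map-++ F (map (c zero ∷_) fs) rest) ⟩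
    sumˡ (map F (map (c zero ∷_) fs) ++ map F rest)
      ≡⟨ sum-++ (map F (map (c zero ∷_) fs)) (map F rest) ⟩
    sumˡ (map F (map (c zero ∷_) fs)) + sumˡ (map F rest)
      ≡⟨ cong₂ _+_ (trans (cong sumˡ (sym (map-∘ fs))) (sumMaps-allMaps N (F ∘ (c zero ∷_))))
                   (go m (c ∘ suc)) ⟩
    ∑[ i < suc m ] sumMaps N (F ∘ (c i ∷_)) ∎
    where
    open ≡-Reasoning
    fs : List (Vec (Fin n) N)
    fs = allMaps N n
    rest : List (Vec (Fin n) (suc N))
    rest = cartesianProductWith _∷_ (tabulate (c ∘ suc)) fs

length-filter-indicator : ∀ {a p} {A : Set a} {P : A → Set p} (P? : ∀ x → Dec (P x)) xs →
                          length (filter P? xs) ≡ sumˡ (map (indicator ∘ P?) xs)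
length-filter-indicator P? []       = refl
length-filter-indicator P? (x ∷ xs) with P? x
... | yes _ = cong suc (length-filter-indicator P? xs)
... | no  _ = length-filter-indicator P? xs

data Punched {N} (ℓ : Fin (suc N)) : Fin (suc N) → Set where
  here  : Punched ℓ ℓ
  there : ∀ v → Punched ℓ (punchIn ℓ v)

punched : ∀ {N} (ℓ u : Fin (suc N)) → Punched ℓ u
punched ℓ u with ℓ Fin.≟ u
... | yes refl = here
... | no  ℓ≢u  = subst (Punched ℓ) (punchIn-punchOut ℓ≢u) (there (punchOut ℓ≢u))

-- ℓ is a leaf of G attached to the vertex p of G′ = G − ℓ.
record Pendant {N} (G : SimpleGraph (suc N)) (G′ : SimpleGraph N) (ℓ : Fin (suc N)) (p : Fin N) : Set where
  open SimpleGraph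
  field
    induced  : ∀ u v → Adj G′ u v ⇔ Adj G (punchIn ℓ u) (punchIn ℓ v)
    attached : Adj G ℓ (punchIn ℓ p)
    unique   : ∀ v → Adj G ℓ (punchIn ℓ v) → v ≡ p

module _ {n : ℕ} (H : Graph n) where
  open Graph H

  -- The weights record branches that have already been pruned, so that removing a leaf stays within
  -- this class of counts.
  weightedHom : ∀ {N} → SimpleGraph N → (Fin N → Weight n) → ℕ
  weightedHom {N} G x =
    sumMaps N (λ f → indicator (isColoring? G H f) * product (λ v → x v (lookup f v)))

  hom-weightedHom : ∀ {N} (G : SimpleGraph N) → hom G H ≡ weightedHom G (λ _ → 𝟙)
  hom-weightedHom {N} G = begin
    hom G H
      ≡⟨ length-filter-indicator (isColoring? G H) (allMaps N n) ⟩
    sumˡ (map (indicator ∘ isColoring? G H) (allMaps N n))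
      ≡⟨ sumMaps-allMaps N (indicator ∘ isColoring? G H) ⟩
    sumMaps N (indicator ∘ isColoring? G H)
      ≡⟨ (sumMaps-cong N λ f → sym (trans (cong (indicator (isColoring? G H f) *_) (product-𝟙 N))
                                         (*-identityʳ _))) ⟩
    weightedHom G (λ _ → 𝟙) ∎
    where
    open ≡-Reasoning
    product-𝟙 : ∀ N → product {N} (λ _ → 1) ≡ 1
    product-𝟙 zero    = refl
    product-𝟙 (suc N) = trans (*-identityˡ _) (product-𝟙 N)

  weightedHom-single : (G : SimpleGraph 1) (x : Fin 1 → Weight n) → weightedHom G x ≡ sum (x zero)
  weightedHom-single G x = sum-cong-≗ λ i → trans
    (cong (_* (x zero i * 1)) (indicator-yes (isColoring? G H (i ∷ []))
      λ { zero zero a → ⊥-elim (SimpleGraph.loopless G refl a) }))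
    (trans (*-identityˡ _) (*-identityʳ _))

  module _ {N} {G : SimpleGraph (suc N)} {G′ : SimpleGraph N} {ℓ p} (pendant : Pendant G G′ ℓ p) where
    open Pendant pendant
    open SimpleGraph G using () renaming (Adj to _~_; adj-sym to ~-sym; loopless to ~-irrefl)

    isColoring-insertAt : ∀ f i →
      IsColoring G H (insertAt f ℓ i) ⇔ (IsColoring G′ H f × Adj (lookup f p) i)
    isColoring-insertAt f i = mk⇔ restrict extendℓ
      where
      at-ℓ : lookup (insertAt f ℓ i) ℓ ≡ i
      at-ℓ = insertAt-lookup f ℓ i
      off-ℓ : ∀ v → lookup (insertAt f ℓ i) (punchIn ℓ v) ≡ lookup f v
      off-ℓ = insertAt-punchIn f ℓ i
      restrict : IsColoring G H (insertAt f ℓ i) → IsColoring G′ H f × Adj (lookup f p) i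
      restrict c =
        (λ u v u~v → subst₂ Adj (off-ℓ u) (off-ℓ v) (c _ _ (Equivalence.to (induced u v) u~v))) ,
        subst₂ Adj (off-ℓ p) at-ℓ (c _ _ (~-sym attached))
      extendℓ : IsColoring G′ H f × Adj (lookup f p) i → IsColoring G H (insertAt f ℓ i)
      extendℓ (c , a) u v u~v with punched ℓ u | punched ℓ v
      ... | here    | here    = ⊥-elim (~-irrefl refl u~v)
      ... | here    | there v′ with refl ← unique v′ u~v =
        subst₂ Adj (sym at-ℓ) (sym (off-ℓ v′)) (adj-sym a)
      extendℓ (c , a) u v u~v | there u′ | here with refl ← unique u′ (~-sym u~v) =
        subst₂ Adj (sym (off-ℓ u′)) (sym at-ℓ) a
      extendℓ (c , a) u v u~v | there u′ | there v′ =
        subst₂ Adj (sym (off-ℓ u′)) (sym (off-ℓ v′)) (c u′ v′ (Equivalence.from (induced u′ v′) u~v))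

    -- The colour of `ℓ` is summed out. Only the colour of `p` constrains it, so the result is a
    -- factor `neighbourSum H (x ℓ)` in the weight of `p`.
    weightedHom-pendant : ∀ x → weightedHom G x ≡
      weightedHom G′ (updateAt (removeAt x ℓ) p (_⊙ neighbourSum H (x ℓ)))
    weightedHom-pendant x = begin
      weightedHom G x
        ≡⟨ sumMaps-insertAt N ℓ (λ f → indicator (isColoring? G H f) * product (λ v → x v (lookup f v))) ⟩
      ∑[ i < n ] sumMaps N (λ f → indicator (isColoring? G H (insertAt f ℓ i)) *
                                  product (λ v → x v (lookup (insertAt f ℓ i) v)))
        ≡⟨ (sum-cong-≗ λ i → sumMaps-cong N λ f → term f i) ⟩
      ∑[ i < n ] sumMaps N (λ f → col f * rest f * (a f i * x ℓ i))
        ≡⟨ ∑-sumMaps-comm N n (λ i f → col f * rest f * (a f i * x ℓ i)) ⟩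
      sumMaps N (λ f → ∑[ i < n ] col f * rest f * (a f i * x ℓ i))
        ≡⟨ (sumMaps-cong N λ f → collect f) ⟩
      weightedHom G′ (updateAt (removeAt x ℓ) p (_⊙ neighbourSum H (x ℓ))) ∎
      where
      open ≡-Reasoning
      col rest : Vec (Fin n) N → ℕ
      col f  = indicator (isColoring? G′ H f)
      rest f = product (λ v → removeAt x ℓ v (lookup f v))
      a : Vec (Fin n) N → Weight n
      a f i = indicator (adj? (lookup f p) i)
      rearrange : ∀ a b c d → a * b * (c * d) ≡ a * d * (b * c)
      rearrange = solve-∀
      assoc-comm : ∀ a b c → a * b * c ≡ a * (c * b)
      assoc-comm = solve-∀
      term : ∀ f i → indicator (isColoring? G H (insertAt f ℓ i)) *
                     product (λ v → x v (lookup (insertAt f ℓ i) v)) ≡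
                     col f * rest f * (a f i * x ℓ i)
      term f i = trans (cong₂ _*_
        (trans (indicator-cong (isColoring? G H (insertAt f ℓ i))
                 (isColoring? G′ H f ×-dec adj? (lookup f p) i) (isColoring-insertAt f i))
               (indicator-× (isColoring? G′ H f) (adj? (lookup f p) i)))
        (trans (product-remove {i = ℓ} (λ v → x v (lookup (insertAt f ℓ i) v)))
          (cong₂ _*_ (cong (x ℓ) (insertAt-lookup f ℓ i))
            (product-cong λ v → cong (x (punchIn ℓ v)) (insertAt-punchIn f ℓ i v)))))
        (rearrange (col f) (a f i) (x ℓ i) (rest f))
      collect : ∀ f → ∑[ i < n ] col f * rest f * (a f i * x ℓ i) ≡
        col f * product (λ v → updateAt (removeAt x ℓ) p (_⊙ neighbourSum H (x ℓ)) v (lookup f v))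
      collect f = begin
        ∑[ i < n ] col f * rest f * (a f i * x ℓ i)
          ≡⟨ *-distribˡ-sum (col f * rest f) (λ i → a f i * x ℓ i) ⟨
        col f * rest f * neighbourSum H (x ℓ) (lookup f p)
          ≡⟨ assoc-comm (col f) (rest f) (neighbourSum H (x ℓ) (lookup f p)) ⟩
        col f * (neighbourSum H (x ℓ) (lookup f p) * rest f)
          ≡⟨ cong (col f *_) (product-updateAt (removeAt x ℓ) p (neighbourSum H (x ℓ)) (lookup f)) ⟨
        col f * product (λ v → updateAt (removeAt x ℓ) p (_⊙ neighbourSum H (x ℓ)) v (lookup f v)) ∎

-- Trees

path-connected : ∀ {N} → Connected (path N)
path-connected {suc N} u v = reverse Sum.swap (fromZero u) ◅◅ fromZero v
  where
  fromZero : ∀ {N} (u : Fin (suc N)) → Star (SimpleGraph.Adj (path (suc N))) zero u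
  fromZero         zero    = ε
  fromZero {suc N} (suc u) = inj₁ refl ◅ gmap suc (Sum.map (cong suc) (cong suc)) (fromZero u)

UnitSteps : ∀ {m} → (Fin (suc m) → ℕ) → Set
UnitSteps {m} d = ∀ (i : Fin m) → d (suc i) ≡ suc (d (inject₁ i)) ⊎ d (inject₁ i) ≡ suc (d (suc i))

-- A step down after a step up would repeat the value two places before, against injectivity, so the
-- sequence keeps rising.
ascent : ∀ {m} (d : Fin (2 + m) → ℕ) → Injective _≡_ _≡_ d → UnitSteps d →
         d (suc zero) ≡ suc (d zero) → d (fromℕ (suc m)) ≡ suc m + d zero
ascent {zero}  d inj steps up = up
ascent {suc m} d inj steps up with steps (suc zero)
... | inj₁ up′  = trans (ascent (d ∘ suc) (Fin-suc-injective ∘ inj) (steps ∘ suc) up′)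
                        (trans (cong (suc m +_) up) (+-suc (suc m) (d zero)))
... | inj₂ down with () ← inj {zero} {suc (suc zero)} (suc-injective (trans (sym up) down))

descent : ∀ {m} (d : Fin (2 + m) → ℕ) → Injective _≡_ _≡_ d → UnitSteps d →
          d zero ≡ suc (d (suc zero)) → d zero ≡ suc m + d (fromℕ (suc m))
descent {zero}  d inj steps down = down
descent {suc m} d inj steps down with steps (suc zero)
... | inj₂ down′ = trans down (cong suc (descent (d ∘ suc) (Fin-suc-injective ∘ inj) (steps ∘ suc) down′))
... | inj₁ up with () ← inj {zero} {suc (suc zero)} (trans down (sym up))

path-acyclic : ∀ {N} → Acyclic (path N)
path-acyclic {N} {k} c (inj , steps , closing) = go (steps zero) closing
  where
  d : Fin (3 + k) → ℕ
  d = toℕ ∘ c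
  last : Fin (3 + k)
  last = fromℕ (2 + k)
  -- By monotonicity the first and last vertices of the sequence lie `2 + k` apart, too far for the
  -- closing edge.
  far : ∀ a b → a ≡ 2 + k + b → ¬ (b ≡ suc a ⊎ a ≡ suc b)
  far _ b refl (inj₁ e) = m≢1+n+m b {2 + k} e
  far _ b refl (inj₂ e) = m≢1+n+m b {k} (sym (suc-injective e))
  go : d (suc zero) ≡ suc (d zero) ⊎ d zero ≡ suc (d (suc zero)) →
       ¬ (d zero ≡ suc (d last) ⊎ d last ≡ suc (d zero))
  go (inj₁ up)   = far (d last) (d zero) (ascent d (inj ∘ toℕ-injective) steps up)
  go (inj₂ down) = far (d zero) (d last) (descent d (inj ∘ toℕ-injective) steps down) ∘ Sum.swap

path-isTree : ∀ {N} → IsTree (path N)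
path-isTree = path-connected , path-acyclic

-- Simple walks are indexed by ℕ, with junk values beyond their length k.
record SimpleWalk {N} (G : SimpleGraph N) (r : Fin N) (k : ℕ) : Set where
  open SimpleGraph G
  field
    vertex   : ℕ → Fin N
    adjacent : ∀ {i} → i < k → Adj (vertex i) (vertex (suc i))
    distinct : ∀ {i j} → i ≤ k → j ≤ k → vertex i ≡ vertex j → i ≡ j
    end      : vertex k ≡ r

module _ {N} (G : SimpleGraph N) where
  open SimpleGraph G

  Leaf : Fin N → Fin N → Set
  Leaf ℓ p = Adj ℓ p × (∀ v → Adj ℓ v → v ≡ p)

  walk-length : ∀ {r k} → SimpleWalk G r k → suc k ≤ N
  walk-length w = injective⇒≤ {f = λ i → vertex (toℕ i)}
    (λ e → toℕ-injective (distinct (s≤s⁻¹ (toℕ<n _)) (s≤s⁻¹ (toℕ<n _)) e))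
    where open SimpleWalk w

  -- A simple walk that cannot be prolonged beyond its first vertex starts at a
  -- leaf, since another neighbour on the walk would close a cycle.
  leaf-from-walk : Acyclic G → ∀ fuel {r k} → N ≤ fuel + suc k → SimpleWalk G r (suc k) →
                   ∃[ ℓ ] ∃[ p ] (ℓ ≢ r × Leaf ℓ p)
  leaf-from-walk acyclic fuel {r} {k} bound w
    with any? (λ v → adj? (SimpleWalk.vertex w 0) v ×-dec ¬? (v Fin.≟ SimpleWalk.vertex w 1))
  ... | no none = vertex 0 , vertex 1 ,
    (λ e → 0≢1+n (distinct z≤n ≤-refl (trans e (sym end)))) ,
    adjacent (s≤s z≤n) , λ v a → decidable-stable (v Fin.≟ vertex 1) (λ v≢ → none (v , a , v≢))
    where
    open SimpleWalk w
  ... | yes (v , a , v≢) with any? (λ (i : Fin (2 + k)) → SimpleWalk.vertex w (toℕ i) Fin.≟ v)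
  ...   | yes (zero , e)        = ⊥-elim (loopless e a)
  ...   | yes (suc zero , e)    = ⊥-elim (v≢ (sym e))
  ...   | yes (suc (suc j) , e) = ⊥-elim (acyclic (λ i → vertex (toℕ i)) (inj , steps , closing))
    where
    open SimpleWalk w
    in-range : ∀ (i : Fin (3 + toℕ j)) → toℕ i ≤ suc k
    in-range i = ≤-trans (s≤s⁻¹ (toℕ<n i)) (s≤s (toℕ<n j))
    inj : Injective _≡_ _≡_ (λ (i : Fin (3 + toℕ j)) → vertex (toℕ i))
    inj {i} {i′} e = toℕ-injective (distinct (in-range i) (in-range i′) e)
    steps : ∀ (i : Fin (2 + toℕ j)) → Adj (vertex (toℕ (inject₁ i))) (vertex (suc (toℕ i)))
    steps i rewrite toℕ-inject₁ i = adjacent (in-range (suc i))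
    closing : Adj (vertex (toℕ (fromℕ (2 + toℕ j)))) (vertex 0)
    closing rewrite toℕ-fromℕ (toℕ j) | e = adj-sym a
  -- The walk has `2 + k` distinct vertices, while without fuel `bound` allows at most `suc k`.
  leaf-from-walk acyclic zero       bound w | yes _ | no _ = ⊥-elim (<⇒≱ (walk-length w) bound)
  leaf-from-walk acyclic (suc fuel) {r} {k} bound w | yes (v , a , _) | no new =
    leaf-from-walk acyclic fuel (≤-trans bound (≤-reflexive (sym (+-suc fuel (suc k))))) longer
    where
    open SimpleWalk w
    new′ : ∀ {i} → i ≤ suc k → vertex i ≢ v
    new′ i≤ e = new (Fin.fromℕ< (s≤s i≤) , trans (cong vertex (toℕ-fromℕ< (s≤s i≤))) e)
    vertex⁺ : ℕ → Fin N
    vertex⁺ zero    = v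
    vertex⁺ (suc i) = vertex i
    adjacent⁺ : ∀ {i} → i < 2 + k → Adj (vertex⁺ i) (vertex⁺ (suc i))
    adjacent⁺ {zero}  _         = adj-sym a
    adjacent⁺ {suc i} (s≤s i<k) = adjacent i<k
    distinct⁺ : ∀ {i j} → i ≤ 2 + k → j ≤ 2 + k → vertex⁺ i ≡ vertex⁺ j → i ≡ j
    distinct⁺ {zero}  {zero}  _        _        _ = refl
    distinct⁺ {zero}  {suc j} _        (s≤s j≤) e = ⊥-elim (new′ j≤ (sym e))
    distinct⁺ {suc i} {zero}  (s≤s i≤) _        e = ⊥-elim (new′ i≤ e)
    distinct⁺ {suc i} {suc j} (s≤s i≤) (s≤s j≤) e = cong suc (distinct i≤ j≤ e)
    longer : SimpleWalk G r (2 + k)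
    longer = record { vertex = vertex⁺ ; adjacent = adjacent⁺ ; distinct = distinct⁺ ; end = end }

neighbour : ∀ {N} (G : SimpleGraph (2 + N)) → Connected G → ∀ r → ∃[ x ] SimpleGraph.Adj G r x
neighbour G connected zero with connected zero (suc zero)
... | r~x ◅ _ = _ , r~x
neighbour G connected (suc r) with connected (suc r) zero
... | r~x ◅ _ = _ , r~x

-- The walk begins as a single edge ending at `r` and is prolonged only at its other end, so the
-- leaf found is not `r` and the root survives all prunings.
exists-leaf : ∀ {N} (G : SimpleGraph (2 + N)) → IsTree G → ∀ r → ∃[ ℓ ] ∃[ p ] (ℓ ≢ r × Leaf G ℓ p)
exists-leaf {N} G (connected , acyclic) r with x , r~x ← neighbour G connected r =
  leaf-from-walk G acyclic (2 + N) (m≤m+n (2 + N) 1) (record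
    { vertex   = vertex
    ; adjacent = λ { (s≤s z≤n) → adj-sym r~x }
    ; distinct = distinct
    ; end      = refl
    })
  where
  open SimpleGraph G
  vertex : ℕ → Fin (2 + N)
  vertex zero    = x
  vertex (suc _) = r
  distinct : ∀ {i j} → i ≤ 1 → j ≤ 1 → vertex i ≡ vertex j → i ≡ j
  distinct z≤n       z≤n       _ = refl
  distinct z≤n       (s≤s z≤n) e = ⊥-elim (loopless (sym e) r~x)
  distinct (s≤s z≤n) z≤n       e = ⊥-elim (loopless e r~x)
  distinct (s≤s z≤n) (s≤s z≤n) _ = refl

-- Deleting a leaf

delete : ∀ {N} → SimpleGraph (suc N) → Fin (suc N) → SimpleGraph N
delete G ℓ = record
  { graph = record
    { Adj     = λ u v → Adj (punchIn ℓ u) (punchIn ℓ v)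
    ; adj?    = λ u v → adj? (punchIn ℓ u) (punchIn ℓ v)
    ; adj-sym = adj-sym
    }
  ; loopless = loopless ∘ cong (punchIn ℓ)
  }
  where open SimpleGraph G

module _ {N} {G : SimpleGraph (suc N)} {ℓ : Fin (suc N)} where
  open SimpleGraph G

  leaf⇒pendant : ∀ {p} → Leaf G ℓ p → ∃[ p′ ] Pendant G (delete G ℓ) ℓ p′
  leaf⇒pendant {p} (ℓ~p , unique) with punched ℓ p
  ... | here     = ⊥-elim (loopless refl ℓ~p)
  ... | there p′ = p′ , record
    { induced  = λ u v → mk⇔ (λ a → a) (λ a → a)
    ; attached = ℓ~p
    ; unique   = λ v a → punchIn-injective ℓ v p′ (unique (punchIn ℓ v) a)
    }

  delete-acyclic : Acyclic G → Acyclic (delete G ℓ)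
  delete-acyclic acyclic c (inj , steps , closing) =
    acyclic (punchIn ℓ ∘ c) ((λ e → inj (punchIn-injective ℓ _ _ e)) , steps , closing)

  -- Contracting the edge at ℓ maps walks of G to walks of G − ℓ.
  delete-connected : ∀ {p} → Pendant G (delete G ℓ) ℓ p → Connected G → Connected (delete G ℓ)
  delete-connected {p} pendant connected u v =
    subst₂ (Star Adj′) (contract-punchIn u) (contract-punchIn v)
      (kleisliStar contract contract-step (connected (punchIn ℓ u) (punchIn ℓ v)))
    where
    open Pendant pendant
    Adj′ : Fin N → Fin N → Set
    Adj′ = SimpleGraph.Adj (delete G ℓ)
    contract-view : ∀ {u} → Punched ℓ u → Fin N
    contract-view here      = p
    contract-view (there u) = u
    contract : Fin (suc N) → Fin N
    contract u = contract-view (punched ℓ u)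
    contract-step : ∀ {u v} → Adj u v → Star Adj′ (contract u) (contract v)
    contract-step {u} {v} u~v with punched ℓ u | punched ℓ v
    ... | here     | here     = ε
    ... | here     | there v′ with refl ← unique v′ u~v = ε
    contract-step u~v | there u′ | here with refl ← unique u′ (adj-sym u~v) = ε
    contract-step u~v | there u′ | there v′ = u~v ◅ ε
    contract-punchIn : ∀ u → contract (punchIn ℓ u) ≡ u
    contract-punchIn u = view-punchIn (punched ℓ (punchIn ℓ u)) refl
      where
      view-punchIn : ∀ {w} (q : Punched ℓ w) → w ≡ punchIn ℓ u → contract-view q ≡ u
      view-punchIn here       e = ⊥-elim (punchInᵢ≢i ℓ u (sym e))
      view-punchIn (there u′) e = punchIn-injective ℓ u′ u e

exists-pendant : ∀ {N} (G : SimpleGraph (2 + N)) → IsTree G → ∀ r →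
  ∃[ ℓ ] (ℓ ≢ r × IsTree (delete G ℓ) × ∃[ p ] Pendant G (delete G ℓ) ℓ p)
exists-pendant G tree@(connected , acyclic) r with exists-leaf G tree r
... | ℓ , _ , ℓ≢r , leaf with leaf⇒pendant {G = G} leaf
...   | p , pendant =
  ℓ , ℓ≢r , (delete-connected {G = G} pendant connected , delete-acyclic {G = G} {ℓ} acyclic) , p , pendant

-- Extending isomorphisms over a pendant vertex

insert-self : ∀ {N} i j (π : Permutation′ N) → insert i j π ⟨$⟩ʳ i ≡ j
insert-self i j π with i Fin.≟ i
... | yes _  = refl
... | no i≢i = ⊥-elim (i≢i refl)

-- Each added leaf has a single neighbour, so sending leaf to leaf preserves adjacency once `π`
-- takes `p` to `q`; injectivity of `π` reflects it.
≅-insert : ∀ {N} {G K : SimpleGraph (suc N)} {G′ K′ : SimpleGraph N} {ℓ k p q} →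
  Pendant G G′ ℓ p → Pendant K K′ k q → ((π , _) : G′ ≅ K′) → π ⟨$⟩ʳ p ≡ q →
  ∀ u v → SimpleGraph.Adj G u v ⇔ SimpleGraph.Adj K (insert ℓ k π ⟨$⟩ʳ u) (insert ℓ k π ⟨$⟩ʳ v)
≅-insert {N} {G} {K} {G′} {K′} {ℓ} {k} {p} P Q (π , iso) refl u v with punched ℓ u | punched ℓ v
... | here | here rewrite insert-self ℓ k π =
  mk⇔ (⊥-elim ∘ SimpleGraph.loopless G refl) (⊥-elim ∘ SimpleGraph.loopless K refl)
... | here | there v′ rewrite insert-self ℓ k π | insert-punchIn ℓ k π v′ = at-leaf v′
  where
  at-leaf : ∀ v → SimpleGraph.Adj G ℓ (punchIn ℓ v) ⇔ SimpleGraph.Adj K k (punchIn k (π ⟨$⟩ʳ v))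
  at-leaf v = mk⇔
    (λ a → subst (λ v → SimpleGraph.Adj K k (punchIn k (π ⟨$⟩ʳ v))) (sym (Pendant.unique P v a)) (Pendant.attached Q))
    (λ a → subst (λ v → SimpleGraph.Adj G ℓ (punchIn ℓ v))
      (sym (Injection.injective (↔⇒↣ π) (Pendant.unique Q (π ⟨$⟩ʳ v) a))) (Pendant.attached P))
... | there u′ | here rewrite insert-self ℓ k π | insert-punchIn ℓ k π u′ = at-leaf u′
  where
  at-leaf : ∀ v → SimpleGraph.Adj G (punchIn ℓ v) ℓ ⇔ SimpleGraph.Adj K (punchIn k (π ⟨$⟩ʳ v)) k
  at-leaf v = mk⇔
    (λ a → subst (λ v → SimpleGraph.Adj K (punchIn k (π ⟨$⟩ʳ v)) k)
      (sym (Pendant.unique P v (SimpleGraph.adj-sym G a))) (SimpleGraph.adj-sym K (Pendant.attached Q)))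
    (λ a → subst (λ v → SimpleGraph.Adj G (punchIn ℓ v) ℓ)
      (sym (Injection.injective (↔⇒↣ π) (Pendant.unique Q (π ⟨$⟩ʳ v) (SimpleGraph.adj-sym K a))))
      (SimpleGraph.adj-sym G (Pendant.attached P)))
... | there u′ | there v′ rewrite insert-punchIn ℓ k π u′ | insert-punchIn ℓ k π v′ = mk⇔
  (Equivalence.to (Pendant.induced Q _ _) ∘ Equivalence.to (iso u′ v′) ∘ Equivalence.from (Pendant.induced P u′ v′))
  (Equivalence.to (Pendant.induced P u′ v′) ∘ Equivalence.from (iso u′ v′) ∘ Equivalence.from (Pendant.induced Q _ _))

pendant-first : ∀ N → Pendant (path (2 + N)) (path (1 + N)) zero zero
pendant-first N = record
  { induced  = λ u v → mk⇔ (Sum.map (cong suc) (cong suc)) (Sum.map suc-injective suc-injective)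
  ; attached = inj₁ refl
  ; unique   = λ { v (inj₁ e) → toℕ-injective (suc-injective e) }
  }

toℕ-punchIn-fromℕ : ∀ {N} (v : Fin N) → toℕ (punchIn (fromℕ N) v) ≡ toℕ v
toℕ-punchIn-fromℕ zero    = refl
toℕ-punchIn-fromℕ (suc v) = cong suc (toℕ-punchIn-fromℕ v)

-- While `assemble` grows the path at `zero`, the leaf split off in `hom-path-<` is put back at this
-- other end.
pendant-last : ∀ N → Pendant (path (2 + N)) (path (1 + N)) (fromℕ (suc N)) (fromℕ N)
pendant-last N = record
  { induced  = induced
  ; attached = inj₂ (cong suc (sym (toℕ-punchIn-fromℕ (fromℕ N))))
  ; unique   = unique
  }
  where
  ℓ : Fin (2 + N)
  ℓ = fromℕ (suc N)
  induced : ∀ u v → Consecutive u v ⇔ Consecutive (punchIn ℓ u) (punchIn ℓ v)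
  induced u v rewrite toℕ-punchIn-fromℕ u | toℕ-punchIn-fromℕ v = mk⇔ (λ a → a) (λ a → a)
  unique : ∀ v → Consecutive ℓ (punchIn ℓ v) → v ≡ fromℕ N
  unique v a rewrite toℕ-punchIn-fromℕ v | toℕ-fromℕ N with a
  ... | inj₁ e = ⊥-elim (<⇒≱ (toℕ<n v) (≤-trans (n≤1+n _) (≤-reflexive (sym e))))
  ... | inj₂ e = toℕ-injective (trans (sym (suc-injective e)) (sym (toℕ-fromℕ N)))

-- Assembling a rooted tree by pruning leaves

size : RootedTree → ℕ
size t = suc (edges t)

sum-size-graft : ∀ {N} (t : Fin N → RootedTree) p s →
  sum (size ∘ updateAt t p (_◁ s)) ≡ size s + sum (size ∘ t)
sum-size-graft t zero    s = trans (cong (_+ sum (size ∘ t ∘ suc)) (+-comm (size (t zero)) (size s)))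
                                   (+-assoc (size s) (size (t zero)) _)
sum-size-graft t (suc p) s = trans (cong (size (t zero) +_) (sum-size-graft (t ∘ suc) p s))
  (trans (sym (+-assoc (size (t zero)) (size s) _))
    (trans (cong (_+ sum (size ∘ t ∘ suc)) (+-comm (size (t zero)) (size s)))
      (+-assoc (size s) (size (t zero)) _)))

-- The outcome of hanging the rooted tree t v at every vertex v of G and viewing
-- the result as a tree rooted at r.
record Assembly {N} (G : SimpleGraph (suc N)) (r : Fin (suc N)) (t : Fin (suc N) → RootedTree) : Set₁ where
  field
    tree       : RootedTree
    tree-size  : size tree ≡ sum (size ∘ t)
    tree-hom   : ∀ {n} (H : Graph n) (w : Weight n) (x : Fin (suc N) → Weight n) →
                 (∀ v → v ≢ r → x v ≗ rootedHom H (t v)) → x r ≗ w ⊙ rootedHom H (t r) →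
                 weightedHom H G x ≡ ⟨ w , rootedHom H tree ⟩
    iso        : Linear tree → G ≅ path (suc N)
    iso-root   : ∀ l → proj₁ (iso l) ⟨$⟩ʳ r ≡ fromℕ N
    all-linear : Linear tree → ∀ v → Linear (t v)
    -- Only at the end `zero` may the path still continue, so a vertex carrying a nontrivial branch
    -- has to be sent there.
    iso-nontrivial : ∀ l v → proj₁ (iso l) ⟨$⟩ʳ v ≢ zero → t v ≡ •

assemble-single : ∀ (G : SimpleGraph 1) r t → Assembly G r t
assemble-single G zero t = record
  { tree       = t zero
  ; tree-size  = sym (+-identityʳ _)
  ; tree-hom   = λ H w x _ root → trans (weightedHom-single H G x) (sum-cong-≗ root)
  ; iso        = λ _ → idₚ , λ { zero zero → mk⇔ (⊥-elim ∘ SimpleGraph.loopless G refl)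
                                                 (⊥-elim ∘ SimpleGraph.loopless (path 1) refl) }
  ; iso-root   = λ _ → refl
  ; all-linear = λ { l zero → l }
  ; iso-nontrivial = λ { l zero v≢0 → ⊥-elim (v≢0 refl) }
  }

module _ {N} {G : SimpleGraph (2 + N)} {G′ : SimpleGraph (1 + N)} {ℓ p} (pendant : Pendant G G′ ℓ p)
         (r : Fin (1 + N)) (t : Fin (2 + N) → RootedTree) where

  private
    t′ : Fin (1 + N) → RootedTree
    t′ = updateAt (removeAt t ℓ) p (_◁ t ℓ)

  -- Pruning `ℓ` and grafting its branch at `p` preserves sizes and, by `weightedHom-pendant`,
  -- counts. If the outcome is linear, the nontrivial graft forces `p` to `zero`, and `ℓ` becomes
  -- the new first vertex of the path.
  assemble-pendant : Assembly G′ r t′ → Assembly G (punchIn ℓ r) t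
  assemble-pendant A = record
    { tree       = A.tree
    ; tree-size  = trans A.tree-size (trans (sum-size-graft (removeAt t ℓ) p (t ℓ))
                     (sym (sum-remove {i = ℓ} (size ∘ t))))
    ; tree-hom   = λ H w x off-root root → trans (weightedHom-pendant H pendant x)
                     (A.tree-hom H w _ (off-root′ H w x off-root root) (root′ H w x off-root root))
    ; iso        = λ l → insert ℓ zero (proj₁ (A.iso l)) ,
                     ≅-insert pendant (pendant-first N) (A.iso l) (p-first l)
    ; iso-root   = λ l → trans (insert-punchIn ℓ zero (proj₁ (A.iso l)) r) (cong suc (A.iso-root l))
    ; all-linear = all-linear
    ; iso-nontrivial = nontrivial
    }
    where
    module A = Assembly A
    grafted : t′ p ≡ (t (punchIn ℓ p) ◁ t ℓ)
    grafted = updateAt-updates p (removeAt t ℓ)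
    untouched : ∀ {v} → v ≢ p → t′ v ≡ t (punchIn ℓ v)
    untouched {v} v≢p = updateAt-minimal v p (removeAt t ℓ) v≢p

    module _ {n} (H : Graph n) (w : Weight n) (x : Fin (2 + N) → Weight n)
             (off-root : ∀ v → v ≢ punchIn ℓ r → x v ≗ rootedHom H (t v))
             (root : x (punchIn ℓ r) ≗ w ⊙ rootedHom H (t (punchIn ℓ r))) where
      x′ : Fin (1 + N) → Weight n
      x′ = updateAt (removeAt x ℓ) p (_⊙ neighbourSum H (x ℓ))
      at-ℓ : neighbourSum H (x ℓ) ≗ neighbourSum H (rootedHom H (t ℓ))
      at-ℓ = neighbourSum-cong H (off-root ℓ (punchInᵢ≢i ℓ r ∘ sym))
      at-p : x′ p ≡ x (punchIn ℓ p) ⊙ neighbourSum H (x ℓ)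
      at-p = updateAt-updates p (removeAt x ℓ)
      off-p : ∀ {v} → v ≢ p → x′ v ≡ x (punchIn ℓ v)
      off-p {v} v≢p = updateAt-minimal v p (removeAt x ℓ) v≢p
      off-root′ : ∀ v → v ≢ r → x′ v ≗ rootedHom H (t′ v)
      off-root′ v v≢r i with v Fin.≟ p
      ... | yes refl rewrite at-p | grafted =
        cong₂ _*_ (off-root (punchIn ℓ v) (v≢r ∘ punchIn-injective ℓ v r) i) (at-ℓ i)
      ... | no v≢p rewrite off-p v≢p | untouched v≢p =
        off-root (punchIn ℓ v) (v≢r ∘ punchIn-injective ℓ v r) i
      root′ : x′ r ≗ w ⊙ rootedHom H (t′ r)
      root′ i with r Fin.≟ p
      ... | yes refl rewrite at-p | grafted =
        trans (cong₂ _*_ (root i) (at-ℓ i)) (*-assoc (w i) _ _)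
      ... | no r≢p rewrite off-p r≢p | untouched r≢p = root i

    linear-graft : ∀ {a b} → Linear (a ◁ b) → a ≡ • × Linear b
    linear-graft (•◁ l) = refl , l
    at-pendant : Linear A.tree → t (punchIn ℓ p) ≡ • × Linear (t ℓ)
    at-pendant l = linear-graft (subst Linear grafted (A.all-linear l p))
    p-first : ∀ l → proj₁ (A.iso l) ⟨$⟩ʳ p ≡ zero
    p-first l with (proj₁ (A.iso l) ⟨$⟩ʳ p) Fin.≟ zero
    ... | yes e = e
    ... | no ≢0 with () ← trans (sym grafted) (A.iso-nontrivial l p ≢0)
    all-linear : Linear A.tree → ∀ v → Linear (t v)
    all-linear l v with punched ℓ v
    ... | here     = proj₂ (at-pendant l)
    ... | there v′ with v′ Fin.≟ p
    ...   | yes refl = subst Linear (sym (proj₁ (at-pendant l))) •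
    ...   | no v′≢p  = subst Linear (untouched v′≢p) (A.all-linear l v′)
    nontrivial : ∀ l v → insert ℓ zero (proj₁ (A.iso l)) ⟨$⟩ʳ v ≢ zero → t v ≡ •
    nontrivial l v v≢0 with punched ℓ v
    ... | here     = ⊥-elim (v≢0 (insert-self ℓ zero (proj₁ (A.iso l))))
    ... | there v′ with v′ Fin.≟ p
    ...   | yes refl = proj₁ (at-pendant l)
    ...   | no v′≢p  = trans (sym (untouched v′≢p)) (A.iso-nontrivial l v′
      (λ e → v′≢p (Injection.injective (↔⇒↣ (proj₁ (A.iso l))) (trans e (sym (p-first l))))))

assemble : ∀ {N} (G : SimpleGraph (suc N)) → IsTree G → ∀ r t → Assembly G r t
assemble {zero}  G _    r t = assemble-single G r t
assemble {suc N} G tree r t with exists-pendant G tree r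
... | ℓ , ℓ≢r , tree′ , p , pendant with punched ℓ r
...   | here     = ⊥-elim (ℓ≢r refl)
...   | there r′ = assemble-pendant pendant r′ t (assemble (delete G ℓ) tree′ r′ _)

-- Comparing a tree with the path

assemble-edges : ∀ {N} {G : SimpleGraph (suc N)} {r} (A : Assembly G r (λ _ → •)) →
                 edges (Assembly.tree A) ≡ N
assemble-edges {N} A = suc-injective (trans (Assembly.tree-size A) (sum-1 (suc N)))
  where
  sum-1 : ∀ n → sum {n} (λ _ → 1) ≡ n
  sum-1 zero    = refl
  sum-1 (suc n) = cong suc (sum-1 n)

-- The path is pruned from its first vertex; the weight `iter H k 𝟙` there accounts for `k` vertices
-- already removed.
weightedHom-path : ∀ {n} (H : Graph n) N k (x : Fin (suc N) → Weight n) →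
  x zero ≗ iter H k 𝟙 → (∀ v → x (suc v) ≗ 𝟙) →
  weightedHom H (path (suc N)) x ≡ ⟨ 𝟙 , iter H (k + N) 𝟙 ⟩
weightedHom-path H zero    k x x₀ _ rewrite +-identityʳ k = trans
  (weightedHom-single H (path 1) x) (sum-cong-≗ λ i → trans (x₀ i) (sym (*-identityˡ _)))
weightedHom-path H (suc N) k x x₀ x₊ rewrite +-suc k N = trans
  (weightedHom-pendant H (pendant-first N) x)
  (weightedHom-path H N (suc k) (updateAt (removeAt x zero) zero (_⊙ neighbourSum H (x zero)))
    (λ i → trans (cong₂ _*_ (x₊ zero i) (neighbourSum-cong H x₀ i)) (*-identityˡ _))
    (x₊ ∘ suc))

hom-path : ∀ {n} (H : Graph n) N → hom (path (suc N)) H ≡ ⟨ 𝟙 , iter H N 𝟙 ⟩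
hom-path H N = trans (hom-weightedHom H (path (suc N)))
  (weightedHom-path H N 0 (λ _ → 𝟙) (λ _ → refl) (λ _ _ → refl))

hom-path-≤ : ∀ {n N} (T : SimpleGraph (suc N)) → IsTree T →
             hom (path (suc N)) (loopedPath n) ≤ hom T (loopedPath n)
hom-path-≤ {n} {N} T isTree = begin
  hom (path (suc N)) H       ≡⟨ hom-path H N ⟩
  ⟨ 𝟙 , iter H N 𝟙 ⟩         ≡⟨ cong (λ k → ⟨ 𝟙 , iter H k 𝟙 ⟩) (assemble-edges A) ⟨
  ⟨ 𝟙 , iter H (edges tree) 𝟙 ⟩ ≤⟨ rootedHom-≥ {n} tree {𝟙} central-𝟙 ⟩
  ⟨ 𝟙 , rootedHom H tree ⟩   ≡⟨ tree-hom H 𝟙 (λ _ → 𝟙) (λ _ _ _ → refl) (λ _ → refl) ⟨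
  weightedHom H T (λ _ → 𝟙)  ≡⟨ hom-weightedHom H T ⟨
  hom T H                    ∎
  where
  open ≤-Reasoning
  H : Graph n
  H = loopedPath n
  A : Assembly T zero (λ _ → •)
  A = assemble T isTree zero (λ _ → •)
  open Assembly A

-- Splitting off a leaf first gives the remaining tree the root weight
-- neighbourSum 𝟙, which is already peaked, whereas 𝟙 is not.
hom-path-< : ∀ {n N} (T : SimpleGraph (suc N)) → IsTree T → ¬ (T ≅ path (suc N)) →
             hom (path (suc N)) (loopedPath (3 + n)) < hom T (loopedPath (3 + n))
hom-path-< {n} {zero}  T isTree T≇path =
  ⊥-elim (T≇path (Assembly.iso (assemble T isTree zero (λ _ → •)) •))
hom-path-< {n} {suc N} T isTree T≇path with exists-pendant T isTree zero
... | ℓ , _ , isTree′ , p , pendant = begin-strict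
  hom (path (2 + N)) H            ≡⟨ hom-path H (suc N) ⟩
  ⟨ 𝟙 , iter H (suc N) 𝟙 ⟩        ≡⟨ neighbourSum-adjoint H 𝟙 (iter H N 𝟙) ⟨
  ⟨ w , iter H N 𝟙 ⟩              ≡⟨ cong (λ k → ⟨ w , iter H k 𝟙 ⟩) (assemble-edges A) ⟨
  ⟨ w , iter H (edges tree) 𝟙 ⟩   <⟨ gap ⟩
  ⟨ w , rootedHom H tree ⟩        ≡⟨ tree-hom H w x off-root root ⟨
  weightedHom H (delete T ℓ) x    ≡⟨ weightedHom-pendant H pendant (λ _ → 𝟙) ⟨
  weightedHom H T (λ _ → 𝟙)       ≡⟨ hom-weightedHom H T ⟨
  hom T H                         ∎
  where
  open ≤-Reasoning
  H : Graph (3 + n)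
  H = loopedPath (3 + n)
  w : Weight (3 + n)
  w = neighbourSum H 𝟙
  A : Assembly (delete T ℓ) p (λ _ → •)
  A = assemble (delete T ℓ) isTree′ p (λ _ → •)
  open Assembly A
  x : Fin (suc N) → Weight (3 + n)
  x = updateAt (λ _ → 𝟙) p (_⊙ w)
  off-root : ∀ v → v ≢ p → x v ≗ 𝟙
  off-root v v≢p i = cong (λ y → y i) (updateAt-minimal v p (λ _ → 𝟙) v≢p)
  root : x p ≗ w ⊙ 𝟙
  root i = trans (cong (λ y → y i) (updateAt-updates p (λ _ → 𝟙))) (*-comm 1 (w i))
  gap : ⟨ w , iter H (edges tree) 𝟙 ⟩ < ⟨ w , rootedHom H tree ⟩
  gap with rootedHom-> {n} tree {w} (peaked-neighbourSum {x = 𝟙} central-𝟙 (λ _ → s≤s z≤n))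
  ... | inj₂ lt = lt
  -- If the rest is linear, it is a path with `p` as its last vertex, and reattaching `ℓ` there
  -- makes `T` a path.
  ... | inj₁ l  = ⊥-elim (T≇path (insert ℓ (fromℕ (suc N)) (proj₁ (iso l)) ,
                            ≅-insert pendant (pendant-last N) (iso l) (iso-root l)))

theorem4p7 : (∀ (n : ℕ) → 1 ≤ n → HoffmanLondon (loopedPath n)) × (∀ (n : ℕ) → 3 ≤ n → StronglyHoffmanLondon (loopedPath n))
theorem4p7 = hoffmanLondon , stronglyHoffmanLondon
  where
  hoffmanLondon : ∀ (n : ℕ) → 1 ≤ n → HoffmanLondon (loopedPath n)
  hoffmanLondon n _ (suc N) _ = (path (suc N) , path-isTree , refl) , hom-path-≤ {n} {N}
  stronglyHoffmanLondon : ∀ (n : ℕ) → 3 ≤ n → StronglyHoffmanLondon (loopedPath n)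
  stronglyHoffmanLondon (suc (suc (suc n))) (s≤s (s≤s (s≤s _))) (suc N) _ = hom-path-< {n} {N}
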